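{- Consider the Normal Partizan Domination game on the complete bipartite graph $K_{s,t}$ with parts $S$ and $T$, $|S|=s\geq 2$, $|T|=t\geq 2$, each vertex colored $A$, $B$ or $C$. If every vertex of $S\cup T$ has color $A$ (resp. $B$), the value is $\max\{s,t\}$ (resp. $-\max\{s,t\}$). If each of $S$ and $T$ contains (i) at least one vertex of color $C$ or (ii) at least one vertex of color $A$ and at least one vertex of color $B$, then the value is $0$. If every vertex of $S$ has color $A$ (resp. $B$) and every vertex of $T$ has color $B$ (resp. $A$), then the value is $0$.
   Context: Normal Partizan Domination game: a finite graph $G$ has each vertex colored $A$, $B$ or $C$. Alice and Bob alternately select a vertex; Alice may only select vertices colored $A$ or $C$, Bob only vertices colored $B$ or $C$. A vertex $u$ dominates $v$ if $u=v$ or $uv$ is an edge. A vertex may be selected only if it is playable, i.e. it dominates at least one vertex not dominated by the previously selected vertices; the game ends when the selected vertices form a dominating set. Under normal play the player unable to move loses. The game is regarded as a partizan combinatorial game with Alice as Left and Bob as Right, and its value is its value in Conway's combinatorial game theory ($\{X\mid Y\}$ has Left options $X$ and Right options $Y$; $G=H$ iff $G+(-H)$ is a second-player win; integers $n$ are the usual integer games, $0=\{\mid\}$). -}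

module Defs where

open import Data.Empty using (⊥)
open import Data.Fin using (Fin; splitAt; _↑ˡ_; _↑ʳ_)
open import Data.Fin.Subset using (Subset; _∈_; _⊃_; _∪_; ⁅_⁆) renaming (⊥ to ∅)
open import Data.Fin.Subset.Induction using (⊃-wellFounded)
open import Data.Fin.Subset.Properties using (p⊆p∪q; q⊆p∪q; x∈⁅x⁆)
open import Data.Nat using (ℕ; zero; suc)
import Data.Nat as ℕ
open import Data.Product using (Σ; ∃; _×_; _,_; proj₁)
open import Data.Sum using (_⊎_; inj₁; inj₂; [_,_])
open import Data.Unit using (⊤; tt)
open import Induction.WellFounded using (Acc; acc)
open import Relation.Binary.Definitions using (Symmetric; Decidable)
open import Relation.Binary.PropositionalEquality using (_≡_)
open import Relation.Nullary using (¬_; Dec; yes; no)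

-- ⟨ l ∣ r ⟩ has Left options l i (i : I) and Right options r j (j : J).
-- The families need not be injective; repeating an option does not
-- affect who wins.
data Game : Set₁ where
  ⟨_∣_⟩ : {I J : Set} (l : I → Game) (r : J → Game) → Game

infixl 6 _+_
infix  8 -_
infix  4 _≈_

0ᴳ : Game
0ᴳ = ⟨_∣_⟩ {I = ⊥} {J = ⊥} (λ ()) (λ ())

-_ : Game → Game
- ⟨ l ∣ r ⟩ = ⟨ (λ j → - r j) ∣ (λ i → - l i) ⟩

_+_ : Game → Game → Game
G@(⟨ l ∣ r ⟩) + H@(⟨ l′ ∣ r′ ⟩) =
  ⟨ [ (λ i → l i + H) , (λ i → G + l′ i) ]
  ∣ [ (λ j → r j + H) , (λ j → G + r′ j) ] ⟩

fromℕ : ℕ → Game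
fromℕ zero    = 0ᴳ
fromℕ (suc n) = ⟨_∣_⟩ {I = ⊤} {J = ⊥} (λ _ → fromℕ n) (λ ())

-- Normal play: a player with no option loses.  The suffix says whether
-- the named player is the first or the second to move.
mutual
  LeftWinsFirst : Game → Set
  LeftWinsFirst (⟨_∣_⟩ {I} l r) = Σ I λ i → LeftWinsSecond (l i)

  LeftWinsSecond : Game → Set
  LeftWinsSecond (⟨_∣_⟩ {J = J} l r) = (j : J) → LeftWinsFirst (r j)

mutual
  RightWinsFirst : Game → Set
  RightWinsFirst (⟨_∣_⟩ {J = J} l r) = Σ J λ j → RightWinsSecond (r j)

  RightWinsSecond : Game → Set
  RightWinsSecond (⟨_∣_⟩ {I} l r) = (i : I) → RightWinsFirst (l i)

SecondPlayerWin : Game → Set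
SecondPlayerWin G = LeftWinsSecond G × RightWinsSecond G

_≈_ : Game → Game → Set
G ≈ H = SecondPlayerWin (G + (- H))

record Graph (n : ℕ) : Set₁ where
  field
    Adj    : Fin n → Fin n → Set
    adj?   : Decidable Adj
    sym    : Symmetric Adj
    irrefl : ∀ {v} → ¬ Adj v v

-- The parts of K s t are the images of _↑ˡ t and s ↑ʳ_.
K : (s t : ℕ) → Graph (s ℕ.+ t)
K s t = record
  { Adj    = λ u v → Opposite (splitAt s u) (splitAt s v)
  ; adj?   = λ u v → opposite? (splitAt s u) (splitAt s v)
  ; sym    = λ {u} {v} → opposite-sym (splitAt s u) (splitAt s v)
  ; irrefl = λ {v} → opposite-irrefl (splitAt s v)
  }
  module Bipartite where
  Opposite : Fin s ⊎ Fin t → Fin s ⊎ Fin t → Set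
  Opposite (inj₁ _) (inj₁ _) = ⊥
  Opposite (inj₁ _) (inj₂ _) = ⊤
  Opposite (inj₂ _) (inj₁ _) = ⊤
  Opposite (inj₂ _) (inj₂ _) = ⊥

  opposite? : ∀ x y → Dec (Opposite x y)
  opposite? (inj₁ _) (inj₁ _) = no λ ()
  opposite? (inj₁ _) (inj₂ _) = yes tt
  opposite? (inj₂ _) (inj₁ _) = yes tt
  opposite? (inj₂ _) (inj₂ _) = no λ ()

  opposite-sym : ∀ x y → Opposite x y → Opposite y x
  opposite-sym (inj₁ _) (inj₂ _) _ = tt
  opposite-sym (inj₂ _) (inj₁ _) _ = tt

  opposite-irrefl : ∀ x → ¬ Opposite x x
  opposite-irrefl (inj₁ _) ()
  opposite-irrefl (inj₂ _) ()

data Colour : Set where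
  A B C : Colour

data Player : Set where
  Alice Bob : Player

data MaySelect : Player → Colour → Set where
  Alice-A : MaySelect Alice A
  Alice-C : MaySelect Alice C
  Bob-B   : MaySelect Bob B
  Bob-C   : MaySelect Bob C

module Domination {n : ℕ} (G : Graph n) (colour : Fin n → Colour) where
  open Graph G

  Dominates : Fin n → Fin n → Set
  Dominates u v = u ≡ v ⊎ Adj u v

  DominatedBy : Subset n → Fin n → Set
  DominatedBy X v = ∃ λ u → u ∈ X × Dominates u v

  -- Once X is a dominating set no vertex is playable, so the game ends
  -- there without a separate rule.
  Playable : Subset n → Fin n → Set
  Playable X u = ∃ λ v → Dominates u v × ¬ DominatedBy X v

  Move : Player → Subset n → Set
  Move p X = Σ (Fin n) λ u → MaySelect p (colour u) × Playable X u

  select : ∀ {p} (X : Subset n) → Move p X → Subset n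
  select X m = X ∪ ⁅ proj₁ m ⁆

  select-⊃ : ∀ {p} (X : Subset n) (m : Move p X) → select X m ⊃ X
  select-⊃ X (u , _ , v , u-dom-v , v-undominated) =
    p⊆p∪q ⁅ u ⁆ , u , q⊆p∪q X ⁅ u ⁆ (x∈⁅x⁆ u) ,
    λ u∈X → v-undominated (u , u∈X , u-dom-v)

  position : (X : Subset n) → Acc _⊃_ X → Game
  position X (acc rs) =
    ⟨ (λ (m : Move Alice X) → position (select X m) (rs (select-⊃ X m)))
    ∣ (λ (m : Move Bob   X) → position (select X m) (rs (select-⊃ X m))) ⟩

  game : Game
  game = position ∅ (⊃-wellFounded ∅)

open Domination public using () renaming (game to dominationGame)

module _ {s t : ℕ} (colour : Fin (s ℕ.+ t) → Colour) where

  colourS : Fin s → Colour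
  colourS i = colour (i ↑ˡ t)

  colourT : Fin t → Colour
  colourT j = colour (s ↑ʳ j)

module _ {k : ℕ} (colour : Fin k → Colour) where

  All : Colour → Set
  All x = ∀ i → colour i ≡ x

  Contains : Colour → Set
  Contains x = ∃ λ i → colour i ≡ x

  ContainsCOrBothAB : Set
  ContainsCOrBothAB = Contains C ⊎ (Contains A × Contains B)

{-# OPTIONS --safe #-}

-- If all vertices belong to one player p, the position is compared with an
-- integer n by answering every move in one component with a move in the other.
-- For the lower bound p plays through the larger part, no vertex of which
-- dominates another.  For the upper bound, after the first move only the rest
-- of one part is undominated, and every later move dominates one more vertex.
-- In the other cases the second player answers the first move with a vertex of
-- the opposite part; the two vertices form a dominating set.
module Submission where

open import Defs
open import Data.Empty using (⊥-elim)
open import Data.Fin using (Fin; zero; suc; _↑ˡ_; _↑ʳ_; splitAt; join; punchIn; punchOut)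
open import Data.Fin.Properties using
  (0≢1+n; suc-injective; ↑ˡ-injective; ↑ʳ-injective; splitAt-↑ˡ; splitAt-↑ʳ; join-splitAt;
   punchInᵢ≢i; punchIn-punchOut; ¬Fin0; _≟_)
open import Data.Fin.Subset using (Subset; _∪_; ⁅_⁆; _⊃_) renaming (⊥ to ∅)
open import Data.Fin.Subset.Induction using (⊃-wellFounded)
open import Data.Fin.Subset.Properties using (x∈p∪q⁻; p⊆p∪q; q⊆p∪q; x∈⁅x⁆; x∈⁅y⁆⇒x≡y; ∉⊥)
open import Data.Nat using (ℕ; zero; suc; _≤_; _⊔_; s≤s; z≤n)
open import Data.Nat.Properties using (⊔-sel; m≤m⊔n; m≤n⊔m)
import Data.Nat as ℕ
open import Data.Product using (∃; _×_; _,_; proj₁)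
open import Data.Sum using (_⊎_; inj₁; inj₂; [_,_]; fromInj₁)
open import Data.Unit using (tt)
open import Function using (_∘_)
open import Induction.WellFounded using (Acc; acc)
open import Relation.Binary.PropositionalEquality using (_≡_; _≢_; refl; sym; cong; subst)
open import Relation.Nullary using (¬_; yes; no)

-- Outcomes and integers seen from either player.

data _vs_ : Player → Player → Set where
  Alice-Bob : Alice vs Bob
  Bob-Alice : Bob vs Alice

swap : ∀ {p q} → p vs q → q vs p
swap Alice-Bob = Bob-Alice
swap Bob-Alice = Alice-Bob

-- Indexing outcomes by the player lets each strategy below be described once and then used for
-- Alice and for Bob.
WinsFirst : Player → Game → Set
WinsFirst Alice = LeftWinsFirst
WinsFirst Bob   = RightWinsFirst

WinsSecond : Player → Game → Set
WinsSecond Alice = LeftWinsSecond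
WinsSecond Bob   = RightWinsSecond

Option : Player → Game → Set
Option Alice (⟨_∣_⟩ {I} _ _)     = I
Option Bob   (⟨_∣_⟩ {J = J} _ _) = J

option : ∀ p H → Option p H → Game
option Alice ⟨ l ∣ _ ⟩ = l
option Bob   ⟨ _ ∣ r ⟩ = r

integer : Player → ℕ → Game
integer Alice n = fromℕ n
integer Bob   n = - fromℕ n

¬option-0 : ∀ p → ¬ Option p (- 0ᴳ)
¬option-0 Alice ()
¬option-0 Bob   ()

-- Negation hands the moves of an integer to the other side: `- integer p n` is a stock of `n` free
-- moves for the opponent of `p`.
¬option-own : ∀ p n → ¬ Option p (- integer p n)
¬option-own Alice zero    ()
¬option-own Alice (suc n) ()
¬option-own Bob   zero    ()
¬option-own Bob   (suc n) ()

¬option-zero : ∀ {p q} → p vs q → ¬ Option q (- integer p 0)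
¬option-zero Alice-Bob ()
¬option-zero Bob-Alice ()

option-suc : ∀ {p q} → p vs q → ∀ n (o : Option q (- integer p (suc n))) →
  option q (- integer p (suc n)) o ≡ - integer p n
option-suc Alice-Bob n tt = refl
option-suc Bob-Alice n tt = refl

winsFirst-integer : ∀ {p q} → p vs q → ∀ n G →
  WinsSecond q (G + - integer p n) → WinsFirst q (G + - integer p (suc n))
winsFirst-integer Alice-Bob n ⟨ _ ∣ _ ⟩ w = inj₂ tt , w
winsFirst-integer Bob-Alice n ⟨ _ ∣ _ ⟩ w = inj₂ tt , w

≈-integer : ∀ {p q G} n → p vs q →
  WinsSecond p (G + - integer p n) → WinsSecond q (G + - integer p n) → G ≈ integer p n
≈-integer n Alice-Bob v w = v , w
≈-integer n Bob-Alice v w = w , v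

-- Strategies in the domination game on a graph.

module _ {n : ℕ} (G : Graph n) (colour : Fin n → Colour) where
  open Graph G using (Adj)
  open Domination G colour

  dominated-∪⁻ : ∀ X {u v} → DominatedBy (X ∪ ⁅ u ⁆) v → DominatedBy X v ⊎ Dominates u v
  dominated-∪⁻ X {u} (x , x∈ , d) with x∈p∪q⁻ X ⁅ u ⁆ x∈
  ... | inj₁ x∈X = inj₁ (x , x∈X , d)
  ... | inj₂ x∈u with x∈⁅y⁆⇒x≡y u x∈u
  ...   | refl = inj₂ d

  dominated-∪ˡ : ∀ X {u v} → DominatedBy X v → DominatedBy (X ∪ ⁅ u ⁆) v
  dominated-∪ˡ X {u} (x , x∈X , d) = x , p⊆p∪q ⁅ u ⁆ x∈X , d

  dominated-∪ʳ : ∀ X {u v} → Dominates u v → DominatedBy (X ∪ ⁅ u ⁆) v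
  dominated-∪ʳ X {u} d = u , q⊆p∪q X ⁅ u ⁆ (x∈⁅x⁆ u) , d

  dominated-⁅⁆⁻ : ∀ {u v} → DominatedBy (∅ ∪ ⁅ u ⁆) v → Dominates u v
  dominated-⁅⁆⁻ d with dominated-∪⁻ ∅ d
  ... | inj₁ (_ , x∈∅ , _) = ⊥-elim (∉⊥ x∈∅)
  ... | inj₂ d′            = d′

  -- The accessibility proof of the next position is buried inside `a`; asking for a win under every
  -- `a′` avoids naming it.
  winsFirst-select : ∀ p {X} (a : Acc _⊃_ X) H (m : Move p X) →
    (∀ a′ → WinsSecond p (position (select X m) a′ + H)) →
    WinsFirst p (position X a + H)
  winsFirst-select Alice (acc _) ⟨ _ ∣ _ ⟩ m w = inj₁ m , w _
  winsFirst-select Bob   (acc _) ⟨ _ ∣ _ ⟩ m w = inj₁ m , w _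

  winsSecond-+ : ∀ {p q} → p vs q → ∀ {X} (a : Acc _⊃_ X) H →
    ((m : Move q X) → ∀ a′ → WinsFirst p (position (select X m) a′ + H)) →
    ((o : Option q H) → WinsFirst p (position X a + option q H o)) →
    WinsSecond p (position X a + H)
  winsSecond-+ Alice-Bob (acc _) ⟨ _ ∣ _ ⟩ f g = λ { (inj₁ m) → f m _ ; (inj₂ o) → g o }
  winsSecond-+ Bob-Alice (acc _) ⟨ _ ∣ _ ⟩ f g = λ { (inj₁ m) → f m _ ; (inj₂ o) → g o }

  -- Since `q` owns no vertex, `q` can only spend a unit of the integer. Then `p` selects the next
  -- `f i`: it is playable because it is itself undominated, and by independence the remaining ones
  -- stay undominated.
  winsSecond-independent : ∀ {p q} → p vs q →
    (∀ v → MaySelect p (colour v)) → (∀ v → ¬ MaySelect q (colour v)) →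
    ∀ k {X} (a : Acc _⊃_ X) (f : Fin k → Fin n) →
    (∀ {i j} → i ≢ j → ¬ Dominates (f i) (f j)) →
    (∀ i → ¬ DominatedBy X (f i)) →
    WinsSecond p (position X a + - integer p k)
  winsSecond-independent {p} p-q own ¬other zero a f ind und =
    winsSecond-+ p-q a (- integer p 0)
      (λ (v , sel , _) → ⊥-elim (¬other v sel))
      (⊥-elim ∘ ¬option-zero p-q)
  winsSecond-independent {p} p-q own ¬other (suc k) {X} a f ind und =
    winsSecond-+ p-q a (- integer p (suc k))
      (λ (v , sel , _) → ⊥-elim (¬other v sel))
      (λ o → subst (λ H → WinsFirst p (position X a + H)) (sym (option-suc p-q k o))
        (winsFirst-select p a (- integer p k)
          (f zero , own (f zero) , f zero , inj₁ refl , und zero)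
          (λ a′ → winsSecond-independent p-q own ¬other k a′ (f ∘ suc)
            (λ i≢j → ind (i≢j ∘ suc-injective))
            (λ i d → [ und (suc i) , ind 0≢1+n ] (dominated-∪⁻ X d)))))

  -- The length `k` of such a list bounds the number of undominated vertices, hence the number of
  -- moves left.
  Covers : ∀ {k} → (Fin k → Fin n) → Subset n → Set
  Covers f X = ∀ v → ¬ DominatedBy X v → ∃ λ i → f i ≡ v

  covers-punchIn : ∀ {k X} (f : Fin (suc k) → Fin n) i →
    DominatedBy X (f i) → Covers f X → Covers (f ∘ punchIn i) X
  covers-punchIn f i dom cov v ¬dom with cov v ¬dom
  ... | j , refl with i ≟ j
  ...   | yes refl = ⊥-elim (¬dom dom)
  ...   | no i≢j   = punchOut i≢j , cong f (punchIn-punchOut i≢j)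

  winsSecond-covered : ∀ {p q} → p vs q →
    ∀ {k m} → k ≤ m → ∀ {X} (a : Acc _⊃_ X) (f : Fin k → Fin n) → Covers f X →
    WinsSecond q (position X a + - integer p m)
  winsSecond-covered {p} p-q {m = m} z≤n a f cov =
    winsSecond-+ (swap p-q) a (- integer p m)
      (λ (_ , _ , v , _ , ¬dom) → ⊥-elim (¬Fin0 (proj₁ (cov v ¬dom))))
      (⊥-elim ∘ ¬option-own p m)
  winsSecond-covered {p} {q} p-q {m = suc m} (s≤s k≤m) {X} a f cov =
    winsSecond-+ (swap p-q) a (- integer p (suc m)) reply (⊥-elim ∘ ¬option-own p (suc m))
    where
    reply : (mv : Move p X) → ∀ a′ →
      WinsFirst q (position (select X mv) a′ + - integer p (suc m))
    reply (_ , _ , v , u-dom-v , ¬dom) a′ with cov v ¬dom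
    ... | i , refl = winsFirst-integer p-q m _
      (winsSecond-covered p-q k≤m a′ (f ∘ punchIn i)
        (covers-punchIn f i (dominated-∪ʳ X u-dom-v)
          (λ w ¬dom′ → cov w (¬dom′ ∘ dominated-∪ˡ X))))

  -- Captures what `S` and `T` have in common, so that the strategies need not distinguish them.
  record Part (k : ℕ) : Set where
    field
      vertex      : Fin k → Fin n
      injective   : ∀ {i j} → vertex i ≡ vertex j → i ≡ j
      independent : ∀ i j → ¬ Adj (vertex i) (vertex j)
      exhaustive  : ∀ v → (∃ λ i → vertex i ≡ v) ⊎ (∀ i → Adj (vertex i) v)

    ¬dominates : ∀ {i j} → i ≢ j → ¬ Dominates (vertex i) (vertex j)
    ¬dominates i≢j (inj₁ eq)  = i≢j (injective eq)
    ¬dominates i≢j (inj₂ adj) = independent _ _ adj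

  open Part

  winsSecond-part : ∀ {p q} → p vs q →
    (∀ v → MaySelect p (colour v)) → (∀ v → ¬ MaySelect q (colour v)) →
    ∀ {k} → Part k → WinsSecond p (game + - integer p k)
  winsSecond-part p-q own ¬other {k} P =
    winsSecond-independent p-q own ¬other k (⊃-wellFounded ∅) (vertex P)
      (¬dominates P) (λ _ (_ , x∈∅ , _) → ∉⊥ x∈∅)

  covers-part : ∀ {k} (P : Part (suc k)) i →
    Covers (vertex P ∘ punchIn i) (∅ ∪ ⁅ vertex P i ⁆)
  -- The chosen vertex is adjacent to everything outside its part, so the whole part is a cover; the
  -- chosen vertex itself is then removed from it.
  covers-part P i = covers-punchIn (vertex P) i (dominated-∪ʳ ∅ (inj₁ refl)) λ v ¬dom →
    fromInj₁ (λ adj → ⊥-elim (¬dom (dominated-∪ʳ ∅ (inj₂ (adj i))))) (exhaustive P v)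

  winsSecond-parts : ∀ {p q} → p vs q → ∀ m →
    (∀ v → ∃ λ k → k ≤ m × ∃ λ (P : Part (suc k)) → ∃ λ i → vertex P i ≡ v) →
    WinsSecond q (game + - integer p (suc m))
  winsSecond-parts {p} {q} p-q m parts =
    winsSecond-+ (swap p-q) (⊃-wellFounded ∅) (- integer p (suc m))
      reply (⊥-elim ∘ ¬option-own p (suc m))
    where
    reply : (mv : Move p ∅) → ∀ a →
      WinsFirst q (position (select ∅ mv) a + - integer p (suc m))
    reply (u , _) a with parts u
    -- The opening move leaves at most `k` of the `suc k` vertices of its part undominated, and the
    -- reply leaves `m` of the `suc m` units.
    ... | k , k≤m , P , i , refl = winsFirst-integer p-q m _
      (winsSecond-covered p-q k≤m a (vertex P ∘ punchIn i) (covers-part P i))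

  module _ {k} (P : Part (2 ℕ.+ k)) i {v} (adj : Adj (vertex P i) v) where

    v-adj-part : ∀ j → Adj v (vertex P j)
    -- As a neighbour of a vertex of the part, `v` cannot lie in this independent set.
    v-adj-part j with exhaustive P v
    ... | inj₁ (_ , refl) = ⊥-elim (independent P _ _ adj)
    ... | inj₂ adj′       = Graph.sym G (adj′ j)

    neighbour-playable : Playable (∅ ∪ ⁅ vertex P i ⁆) v
    -- Here the part must have two vertices: one other than `vertex P i` is still undominated, and
    -- `v` dominates it.
    neighbour-playable = vertex P (punchIn i zero) , inj₂ (v-adj-part _) ,
      ¬dominates P (punchInᵢ≢i i zero ∘ sym) ∘ dominated-⁅⁆⁻

    -- The part is dominated by `v`, and everything outside it by `vertex P i`.
    edge-dominating : ∀ w → DominatedBy ((∅ ∪ ⁅ vertex P i ⁆) ∪ ⁅ v ⁆) w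
    edge-dominating w with exhaustive P w
    ... | inj₁ (j , refl) = dominated-∪ʳ _ (inj₂ (v-adj-part j))
    ... | inj₂ adj′       = dominated-∪ˡ _ (dominated-∪ʳ ∅ (inj₂ (adj′ i)))

  game≈0 :
    (∀ u → ∃ λ k → ∃ λ (P : Part (2 ℕ.+ k)) → ∃ λ i → vertex P i ≡ u) →
    (∀ {p q} → p vs q → ∀ u → MaySelect q (colour u) → ∃ λ v → Adj u v × MaySelect p (colour v)) →
    game ≈ 0ᴳ
  game≈0 parts answer = wins Alice-Bob , wins Bob-Alice
    where
    wins : ∀ {p q} → p vs q → WinsSecond p (game + - 0ᴳ)
    wins {p} {q} p-q =
      winsSecond-+ p-q (⊃-wellFounded ∅) (- 0ᴳ) reply (⊥-elim ∘ ¬option-0 q)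
      where
      reply : (m : Move q ∅) → ∀ a → WinsFirst p (position (select ∅ m) a + - 0ᴳ)
      reply (u , sel , _) a with answer p-q u sel | parts u
      ... | v , adj , sel′ | _ , P , i , refl =
        -- After this reply nothing is undominated, so `q` has no move.
        winsFirst-select p a (- 0ᴳ) (v , sel′ , neighbour-playable P i adj) λ a′ →
          winsSecond-+ p-q a′ (- 0ᴳ)
            (λ (_ , _ , w , _ , ¬dom) → ⊥-elim (¬dom (edge-dominating P i adj w)))
            (⊥-elim ∘ ¬option-0 q)

-- The two parts of the complete bipartite graph.

∀-splitAt : ∀ s {t} {P : Fin (s ℕ.+ t) → Set} →
  (∀ i → P (i ↑ˡ t)) → (∀ j → P (s ↑ʳ j)) → ∀ v → P v
∀-splitAt s {t} {P} f g v = subst P (join-splitAt s t v) (case (splitAt s v))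
  where
  case : ∀ x → P (join s t x)
  case (inj₁ i) = f i
  case (inj₂ j) = g j

module _ (s t : ℕ) where
  open Graph (K s t) using (Adj)

  adj-ST : ∀ i j → Adj (i ↑ˡ t) (s ↑ʳ j)
  adj-ST i j rewrite splitAt-↑ˡ s i t | splitAt-↑ʳ s t j = tt

  adj-TS : ∀ j i → Adj (s ↑ʳ j) (i ↑ˡ t)
  adj-TS j i rewrite splitAt-↑ˡ s i t | splitAt-↑ʳ s t j = tt

  ¬adj-SS : ∀ i i′ → ¬ Adj (i ↑ˡ t) (i′ ↑ˡ t)
  ¬adj-SS i i′ rewrite splitAt-↑ˡ s i t | splitAt-↑ˡ s i′ t = λ ()

  ¬adj-TT : ∀ j j′ → ¬ Adj (s ↑ʳ j) (s ↑ʳ j′)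
  ¬adj-TT j j′ rewrite splitAt-↑ʳ s t j | splitAt-↑ʳ s t j′ = λ ()

  module _ (colour : Fin (s ℕ.+ t) → Colour) where

    partS : Part (K s t) colour s
    partS = record
      { vertex      = _↑ˡ t
      ; injective   = ↑ˡ-injective t _ _
      ; independent = ¬adj-SS
      ; exhaustive  = ∀-splitAt s (λ i → inj₁ (i , refl)) (λ j → inj₂ λ i → adj-ST i j)
      }

    partT : Part (K s t) colour t
    partT = record
      { vertex      = s ↑ʳ_
      ; injective   = ↑ʳ-injective s _ _
      ; independent = ¬adj-TT
      ; exhaustive  = ∀-splitAt s (λ i → inj₂ λ j → adj-TS j i) (λ j → inj₁ (j , refl))
      }

-- Values for the colourings of the theorem.

module _ (s t : ℕ) (colour : Fin (suc s ℕ.+ suc t) → Colour) where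

  value≈integer : ∀ {p q} → p vs q →
    (∀ v → MaySelect p (colour v)) → (∀ v → ¬ MaySelect q (colour v)) →
    dominationGame (K (suc s) (suc t)) colour ≈ integer p (suc s ⊔ suc t)
  value≈integer {p} p-q own ¬other = ≈-integer (suc s ⊔ suc t) p-q lower upper
    where
    value = dominationGame (K (suc s) (suc t)) colour

    lower : WinsSecond p (value + - integer p (suc s ⊔ suc t))
    -- The maximum is one of the two sizes; `p` plays through the part attaining it.
    lower with suc s ⊔ suc t | ⊔-sel (suc s) (suc t)
    ... | _ | inj₁ refl = winsSecond-part _ colour p-q own ¬other (partS (suc s) (suc t) colour)
    ... | _ | inj₂ refl = winsSecond-part _ colour p-q own ¬other (partT (suc s) (suc t) colour)

    -- `suc s ⊔ suc t` reduces to `suc (s ⊔ t)`, so the bound on the rest of either part is `s ⊔ t`.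
    upper = winsSecond-parts _ colour p-q (s ⊔ t)
      (∀-splitAt (suc s)
        (λ i → s , m≤m⊔n s t , partS (suc s) (suc t) colour , i , refl)
        (λ j → t , m≤n⊔m s t , partT (suc s) (suc t) colour , j , refl))

-- Every vertex of the opposite part is a neighbour, so whether an opening move has an answer there
-- depends on colours alone.
Answerable : ∀ {k l} → (Fin k → Colour) → (Fin l → Colour) → Set
Answerable c d = ∀ {p q} → p vs q → ∀ i → MaySelect q (c i) → ∃ λ j → MaySelect p (d j)

module _ (s t : ℕ) (colour : Fin (2 ℕ.+ s ℕ.+ (2 ℕ.+ t)) → Colour) where

  value≈0 :
    Answerable (colourS {2 ℕ.+ s} colour) (colourT {2 ℕ.+ s} colour) →
    Answerable (colourT {2 ℕ.+ s} colour) (colourS {2 ℕ.+ s} colour) →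
    dominationGame (K (2 ℕ.+ s) (2 ℕ.+ t)) colour ≈ 0ᴳ
  value≈0 answerS answerT = game≈0 _ colour
    (∀-splitAt (2 ℕ.+ s) (λ i → s , partS _ _ colour , i , refl)
                         (λ j → t , partT _ _ colour , j , refl))
    (λ p-q → ∀-splitAt (2 ℕ.+ s)
      (λ i sel → let j , sel′ = answerS p-q i sel in _ , adj-ST _ _ i j , sel′)
      (λ j sel → let i , sel′ = answerT p-q j sel in _ , adj-TS _ _ j i , sel′))

maySelect-some : ∀ {k} {c : Fin k → Colour} → ContainsCOrBothAB c →
  ∀ p → ∃ λ i → MaySelect p (c i)
maySelect-some (inj₁ (i , eq)) Alice = i , subst (MaySelect Alice) (sym eq) Alice-C
maySelect-some (inj₁ (i , eq)) Bob   = i , subst (MaySelect Bob) (sym eq) Bob-C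
maySelect-some (inj₂ ((i , eq) , _)) Alice = i , subst (MaySelect Alice) (sym eq) Alice-A
maySelect-some (inj₂ (_ , i , eq))   Bob   = i , subst (MaySelect Bob) (sym eq) Bob-B

-- Only Alice can open in the part coloured `A`, and any vertex of the other part, here `zero`,
-- serves Bob.
answer-AB : ∀ {k l} {c : Fin k → Colour} {d : Fin (suc l) → Colour} →
  All c A → All d B → Answerable c d
answer-AB cA dB Alice-Bob i sel with () ← subst (MaySelect Bob) (cA i) sel
answer-AB cA dB Bob-Alice i sel = zero , subst (MaySelect Bob) (sym (dB zero)) Bob-B

answer-BA : ∀ {k l} {c : Fin k → Colour} {d : Fin (suc l) → Colour} →
  All c B → All d A → Answerable c d
answer-BA cB dA Alice-Bob i sel = zero , subst (MaySelect Alice) (sym (dA zero)) Alice-A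
answer-BA cB dA Bob-Alice i sel with () ← subst (MaySelect Alice) (cB i) sel

theorem4 : (s t : ℕ) → 2 ≤ s → 2 ≤ t →
    (colour : Fin (s ℕ.+ t) → Colour) →
    let value = dominationGame (K s t) colour
        S = colourS {s} {t} colour
        T = colourT {s} {t} colour
    in (All colour A → value ≈ fromℕ (s ⊔ t))
     × (All colour B → value ≈ - fromℕ (s ⊔ t))
     × (ContainsCOrBothAB S → ContainsCOrBothAB T → value ≈ 0ᴳ)
     × (All S A → All T B → value ≈ 0ᴳ)
     × (All S B → All T A → value ≈ 0ᴳ)
theorem4 (suc (suc s)) (suc (suc t)) (s≤s (s≤s _)) (s≤s (s≤s _)) colour =
    (λ allA → value≈integer (suc s) (suc t) colour Alice-Bob
      (λ v → subst (MaySelect Alice) (sym (allA v)) Alice-A)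
      (λ v sel → ¬Bob-A (subst (MaySelect Bob) (allA v) sel)))
  , (λ allB → value≈integer (suc s) (suc t) colour Bob-Alice
      (λ v → subst (MaySelect Bob) (sym (allB v)) Bob-B)
      (λ v sel → ¬Alice-B (subst (MaySelect Alice) (allB v) sel)))
  , (λ S-mixed T-mixed → value≈0 s t colour
      (λ {p} _ _ _ → maySelect-some T-mixed p) (λ {p} _ _ _ → maySelect-some S-mixed p))
  , (λ S-A T-B → value≈0 s t colour (answer-AB S-A T-B) (answer-BA T-B S-A))
  , (λ S-B T-A → value≈0 s t colour (answer-BA S-B T-A) (answer-AB T-A S-B))
  where
  ¬Bob-A : ¬ MaySelect Bob A
  ¬Bob-A ()

  ¬Alice-B : ¬ MaySelect Alice B
  ¬Alice-B ()
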